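{- There exists an absolute constant $c>0$ such that for every integer $n>1$, if $G$ is the line graph of the complete graph $K_n$, then the conflict-free chromatic number of $G$ satisfies $\chi_{CF}(G)\ge c\ln n$. (That is, $\chi_{CF}(G)=\Omega(\ln n)$.)
   Context: All graphs are finite and simple. For a vertex $v$ of $G$, the closed neighborhood $N[v]$ consists of $v$ and all its neighbors. A (not necessarily proper) coloring of the vertices of $G$ is conflict-free if for every vertex $v\in V(G)$ there is a color that appears on exactly one vertex of $N[v]$. The conflict-free chromatic number $\chi_{CF}(G)$ is the minimum number of colors in a conflict-free coloring of the vertices of $G$ (every vertex is colored). The line graph of a graph $H$ has vertex set $E(H)$, with two distinct edges of $H$ adjacent iff they share an endpoint. -}

module Defs where

open import Data.Fin as Fin using (Fin; toℕ)
open import Data.Fin.Properties as Fin using (any?; all?)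
open import Data.Integer using (+_)
open import Data.List using (List; []; _∷_; concatMap; allFin; deduplicate; length; lookup)
open import Data.List.Membership.Propositional using (_∈_; lose)
open import Data.List.Membership.Propositional.Properties using (∈-allFin; ∈-concatMap⁺; ∈-deduplicate⁺; ∈-lookup)
open import Data.List.Relation.Unary.All as All using ()
open import Data.List.Relation.Unary.Any using (here; index)
open import Data.List.Relation.Unary.Any.Properties using (lookup-index)
open import Data.List.Relation.Unary.AllPairs using (_∷_)
open import Data.List.Relation.Unary.Unique.Propositional using (Unique)
import Data.List.Relation.Unary.Unique.DecPropositional.Properties as UniqueDec
open import Data.Nat as ℕ using (ℕ; zero; suc; NonZero)
import Data.Nat.Properties as ℕ
open import Data.Product using (∃; ∃!; _×_; _,_; proj₁; proj₂)
open import Data.Rational using (ℚ; 0ℚ; _+_; _*_; _/_; _≤_)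
open import Data.Sum using (_⊎_; inj₁; inj₂)
open import Function using (_∘_; _↔_; mk↔ₛ′; Inverse)
open import Function.Construct.Identity using (↔-id)
open import Function.Properties.Inverse using (↔⇒↣)
open import Relation.Binary.Definitions using (Decidable; DecidableEquality; Symmetric; Irreflexive)
open import Relation.Binary.PropositionalEquality using (_≡_; _≢_; refl; sym; trans; cong; cong₂; subst; ≢-sym)
open import Relation.Nullary using (Dec; yes; no; contradiction; recompute; ¬?; _×-dec_; _⊎-dec_; _→-dec_; map′)
import Relation.Unary as Unary

Finite : Set → Set
Finite A = ∃ λ n → A ↔ Fin n

module _ {A : Set} (fin : Finite A) where
  open Inverse (proj₂ fin)

  finite-≟ : DecidableEquality A
  finite-≟ = Fin.inj⇒≟ (↔⇒↣ (proj₂ fin))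

  finite-any? : {P : A → Set} → Unary.Decidable P → Dec (∃ P)
  finite-any? {P} P? = map′
    (λ (i , p) → from i , p)
    (λ (x , p) → to x , subst P (sym (strictlyInverseʳ x)) p)
    (any? (P? ∘ from))

  finite-all? : {P : A → Set} → Unary.Decidable P → Dec (∀ x → P x)
  finite-all? {P} P? = map′
    (λ h x → subst P (strictlyInverseʳ x) (h (to x)))
    (λ h i → h (from i))
    (all? (P? ∘ from))

lookup-injective : {A : Set} {xs : List A} → Unique xs →
                   ∀ i j → lookup xs i ≡ lookup xs j → i ≡ j
lookup-injective (x∉ ∷ u) Fin.zero    Fin.zero    eq = refl
lookup-injective (x∉ ∷ u) Fin.zero    (Fin.suc j) eq = contradiction eq (All.lookup x∉ (∈-lookup j))
lookup-injective (x∉ ∷ u) (Fin.suc i) Fin.zero    eq = contradiction (sym eq) (All.lookup x∉ (∈-lookup i))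
lookup-injective (x∉ ∷ u) (Fin.suc i) (Fin.suc j) eq = cong Fin.suc (lookup-injective u i j eq)

abstract
  listed⇒finite : {A : Set} → DecidableEquality A →
                  (xs : List A) → (∀ x → x ∈ xs) → Finite A
  listed⇒finite {A} _≟_ xs all = length ys , mk↔ₛ′ pos (lookup ys) pos∘lookup lookup∘pos
    where
    ys : List A
    ys = deduplicate _≟_ xs

    _∈ys : ∀ x → x ∈ ys
    x ∈ys = ∈-deduplicate⁺ _≟_ (all x)

    pos : A → Fin (length ys)
    pos x = index (x ∈ys)

    lookup∘pos : ∀ x → lookup ys (pos x) ≡ x
    lookup∘pos x = sym (lookup-index (x ∈ys))

    pos∘lookup : ∀ i → pos (lookup ys i) ≡ i
    pos∘lookup i = lookup-injective (UniqueDec.deduplicate-! _≟_ xs) _ i (lookup∘pos (lookup ys i))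

record Graph : Set₁ where
  infix 4 _~_ _~?_
  field
    Vertex   : Set
    finite   : Finite Vertex
    _~_      : Vertex → Vertex → Set
    _~?_     : Decidable _~_
    ~-sym    : Symmetric _~_
    ~-irrefl : Irreflexive _≡_ _~_

  number : Vertex → ℕ
  number v = toℕ (Inverse.to (proj₂ finite) v)

completeGraph : ℕ → Graph
completeGraph n = record
  { Vertex   = Fin n
  ; finite   = n , ↔-id (Fin n)
  ; _~_      = _≢_
  ; _~?_     = λ u v → ¬? (u Fin.≟ v)
  ; ~-sym    = ≢-sym
  ; ~-irrefl = λ u≡v u≢v → u≢v u≡v
  }

module _ (H : Graph) where
  open Graph H

  -- The unordered pair {u , v} is represented by the one of (u , v), (v , u)
  -- that is increasing in the numbering of the vertices, and the proofs are
  -- irrelevant, so ≡ on this type is equality of edges.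
  record Edge : Set where
    constructor edge
    field
      end₁ end₂ : Vertex
      .ordered  : number end₁ ℕ.< number end₂
      .adjacent : end₁ ~ end₂

module _ {H : Graph} where
  open Graph H
  open Edge

  _isEndOf_ : Vertex → Edge H → Set
  w isEndOf e = w ≡ end₁ e ⊎ w ≡ end₂ e

  _isEndOf?_ : Decidable _isEndOf_
  w isEndOf? e = finite-≟ finite w (end₁ e) ⊎-dec finite-≟ finite w (end₂ e)

  ShareEnd : Edge H → Edge H → Set
  ShareEnd e f = ∃ λ w → w isEndOf e × w isEndOf f

  shareEnd? : Decidable ShareEnd
  shareEnd? e f = finite-any? finite (λ w → w isEndOf? e ×-dec w isEndOf? f)

  edge-≟ : DecidableEquality (Edge H)
  edge-≟ (edge u v _ _) (edge u′ v′ _ _) = map′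
    (λ { (refl , refl) → refl })
    (λ { refl → refl , refl })
    (finite-≟ finite u u′ ×-dec finite-≟ finite v v′)

  edgeFrom : Vertex → Vertex → List (Edge H)
  edgeFrom u v with number u ℕ.<? number v | u ~? v
  ... | yes u<v | yes u~v = edge u v u<v u~v ∷ []
  ... | _       | _       = []

  ∈-edgeFrom : (e : Edge H) → e ∈ edgeFrom (end₁ e) (end₂ e)
  ∈-edgeFrom (edge u v u<v u~v) with number u ℕ.<? number v | u ~? v
  ... | yes _  | yes _  = here refl
  ... | no u≮v | d      = contradiction (recompute (number u ℕ.<? number v) u<v) u≮v
  ... | yes _  | no u≁v = contradiction (recompute (u ~? v) u~v) u≁v

  edge-finite : Finite (Edge H)
  edge-finite = listed⇒finite edge-≟ edges edges-complete
    where
    open Inverse (proj₂ finite)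

    edges : List (Edge H)
    edges = concatMap (λ i → concatMap (λ j → edgeFrom (from i) (from j)) (allFin _)) (allFin _)

    edges-complete : ∀ e → e ∈ edges
    edges-complete e =
      ∈-concatMap⁺ _ (lose (∈-allFin (to (end₁ e)))
        (∈-concatMap⁺ _ (lose (∈-allFin (to (end₂ e)))
          (subst (e ∈_)
            (sym (cong₂ edgeFrom (strictlyInverseʳ (end₁ e)) (strictlyInverseʳ (end₂ e))))
            (∈-edgeFrom e)))))

lineGraph : Graph → Graph
lineGraph H = record
  { Vertex   = Edge H
  ; finite   = edge-finite
  ; _~_      = λ e f → e ≢ f × ShareEnd e f
  ; _~?_     = λ e f → ¬? (edge-≟ e f) ×-dec shareEnd? e f
  ; ~-sym    = λ (e≢f , w , w∈e , w∈f) → ≢-sym e≢f , w , w∈f , w∈e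
  ; ~-irrefl = λ e≡f (e≢f , _) → e≢f e≡f
  }

module _ (G : Graph) where
  open Graph G

  infix 4 _∈N[_]

  _∈N[_] : Vertex → Vertex → Set
  u ∈N[ v ] = u ≡ v ⊎ v ~ u

  ConflictFree : {k : ℕ} → (Vertex → Fin k) → Set
  ConflictFree φ = ∀ v → ∃ λ a → ∃! _≡_ λ u → u ∈N[ v ] × φ u ≡ a

  CFColourable : ℕ → Set
  CFColourable k = ∃ λ (φ : Vertex → Fin k) → ConflictFree φ

  IsCFChromaticNumber : ℕ → Set
  IsCFChromaticNumber k = CFColourable k × (∀ m → CFColourable m → k ℕ.≤ m)

  ∈N? : Decidable _∈N[_]
  ∈N? u v = finite-≟ finite u v ⊎-dec v ~? u

  conflictFree? : ∀ {k} (φ : Vertex → Fin k) → Dec (ConflictFree φ)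
  conflictFree? φ =
    finite-all? finite λ v → any? λ a → finite-any? finite λ u →
      (∈N? u v ×-dec (φ u Fin.≟ a)) ×-dec
      map′ (λ h {y} → h y) (λ h y → h {y})
        (finite-all? finite λ y → (∈N? y v ×-dec (φ y Fin.≟ a)) →-dec finite-≟ finite u y)

  conflictFree-cong : ∀ {k} {φ ψ : Vertex → Fin k} → (∀ v → φ v ≡ ψ v) →
                      ConflictFree φ → ConflictFree ψ
  conflictFree-cong φ≗ψ cf v with cf v
  ... | a , u , (u∈N , φu≡a) , unique =
    a , u , (u∈N , trans (sym (φ≗ψ u)) φu≡a) , λ (y∈N , ψy≡a) → unique (y∈N , trans (φ≗ψ _) ψy≡a)

  cfColourable? : ∀ k → Dec (CFColourable k)
  cfColourable? k = map′
    (λ (c , cf) → colouring c , cf)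
    (λ (φ , cf) → Fin.funToFin (φ ∘ from) , conflictFree-cong (λ v → sym (colouring-code φ v)) cf)
    (any? (λ c → conflictFree? (colouring c)))
    where
    open Inverse (proj₂ finite)

    colouring : Fin (k ℕ.^ proj₁ finite) → Vertex → Fin k
    colouring c v = Fin.finToFun c (to v)

    colouring-code : ∀ φ v → colouring (Fin.funToFin (φ ∘ from)) v ≡ φ v
    colouring-code φ v = trans (Fin.finToFun-funToFin (φ ∘ from) (to v)) (cong φ (strictlyInverseʳ v))

  rainbow : CFColourable (proj₁ finite)
  rainbow = to , λ v → to v , v , (inj₁ refl , refl) ,
    λ (_ , eq) → trans (sym (strictlyInverseʳ v)) (trans (cong from (sym eq)) (strictlyInverseʳ _))
    where open Inverse (proj₂ finite)

least : {P : ℕ → Set} → Unary.Decidable P → ∀ n → P n →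
        ∃ λ k → P k × (∀ m → P m → k ℕ.≤ m)
least P? zero p = zero , p , λ _ _ → ℕ.z≤n
least {P} P? (suc n) p with P? zero
... | yes p₀ = zero , p₀ , λ _ _ → ℕ.z≤n
... | no ¬p₀ with least (P? ∘ suc) n p
...   | k , pk , k-least = suc k , pk , suc-least
  where
  suc-least : ∀ m → P m → suc k ℕ.≤ m
  suc-least zero    p₀ = contradiction p₀ ¬p₀
  suc-least (suc m) pm = ℕ.s≤s (k-least m pm)

abstract
  cfChromaticNumber : (G : Graph) → ∃ (IsCFChromaticNumber G)
  cfChromaticNumber G = least (cfColourable? G) _ (rainbow G)

χCF : Graph → ℕ
χCF G = proj₁ (cfChromaticNumber G)

-- 1/(k+1) + 1/(k+2) + ⋯ + 1/(k+m)
reciprocalSum : (k m : ℕ) → ℚ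
reciprocalSum k zero    = 0ℚ
reciprocalSum k (suc m) = reciprocalSum k m + (+ 1) / suc (k ℕ.+ m)

-- The lower Riemann sum of ∫₁ⁿ dt/t for the partition of [1 , n] into
-- intervals of length 1/k: the i-th of the (n-1)k intervals ends at (k+i)/k
-- and contributes (1/k)·(k/(k+i)) = 1/(k+i).
lnLowerSum : (n k : ℕ) .{{_ : NonZero k}} → ℚ
lnLowerSum n k = reciprocalSum k ((n ℕ.∸ 1) ℕ.* k)

-- For c ≥ 0 and n ≥ 1, the inequality c · ln n ≤ x between real numbers:
-- ln n = ∫₁ⁿ dt/t is the supremum of the lower sums over k ≥ 1, so c · ln n
-- is the supremum of their c-multiples, and x bounds a supremum from above
-- iff it bounds every member.
infix 4 _·ln_≤_

_·ln_≤_ : ℚ → ℕ → ℚ → Set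
c ·ln n ≤ x = ∀ k .{{_ : NonZero k}} → c * lnLowerSum n k ≤ x

{-# OPTIONS --safe #-}

-- Let φ be a conflict-free colouring of the edges of K_n with k colours, and
-- let S(v) be the set of colours occurring on exactly one edge at v.  If
-- S(x) = S(y), then the colour that appears exactly once around the edge xy
-- must appear on xy itself: otherwise it would occur once at one of the two
-- ends and not at all at the other.  So inside a class of vertices with the
-- same S, the edges from a fixed member r to the others are each the only edge
-- of their colour at r, hence have distinct colours, and the class has at most
-- k + 1 members.  Thus n ≤ 2ᵏ(k + 1) ≤ 4ᵏ, which bounds ln n linearly in k.

module Submission where

open import Defs
open import Data.Fin as Fin using (Fin; toℕ; combine; funToFin; finToFun)
import Data.Fin.Properties as Fin
open import Data.Integer as ℤ using (+_)
import Data.Integer.Properties as ℤ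
open import Data.Nat as ℕ using (ℕ; zero; suc; NonZero)
import Data.Nat.Properties as ℕ
open import Data.Product using (∃; ∃!; _×_; _,_; proj₁; proj₂)
open import Data.Rational using (ℚ; 0ℚ; 1ℚ; ½; _<_; _≤_; _+_; _*_; _/_)
import Data.Rational.Properties as ℚ
open import Data.Rational.Unnormalised as ℚᵘ using (mkℚᵘ; *≤*; *≡*)
import Data.Rational.Unnormalised.Properties as ℚᵘ
open import Data.Sum using (_⊎_; inj₁; inj₂)
open import Function using (_∘_)
open import Relation.Binary.Definitions using (tri<; tri≈; tri>)
open import Relation.Binary.PropositionalEquality using (_≡_; _≢_; refl; sym; trans; cong; cong₂; subst; subst₂; module ≡-Reasoning)
open import Relation.Nullary using (Dec; yes; no; contradiction; recompute; _×-dec_; _→-dec_; map′)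

-- Counting

funToFin-injective : ∀ {m n} (f g : Fin m → Fin n) → funToFin f ≡ funToFin g → ∀ i → f i ≡ g i
funToFin-injective f g eq i =
  trans (sym (Fin.finToFun-funToFin f i))
    (trans (cong (λ c → finToFun c i) eq) (Fin.finToFun-funToFin g i))

indicator : {P : Set} → Dec P → Fin 2
indicator (yes _) = Fin.suc Fin.zero
indicator (no  _) = Fin.zero

indicator-≡⇒ : {P Q : Set} (P? : Dec P) (Q? : Dec Q) → indicator P? ≡ indicator Q? → P → Q
indicator-≡⇒ _       (yes q) _  _ = q
indicator-≡⇒ (yes _) (no _)  () _
indicator-≡⇒ (no ¬p) (no _)  _  p = contradiction p ¬p

module _ {n m k : ℕ} (f : Fin n → Fin m) (label : ∀ r v → r ≢ v → Fin k)
         (label-injective : ∀ {r v w} (r≢v : r ≢ v) (r≢w : r ≢ w) → f r ≡ f v → f r ≡ f w →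
                            label r v r≢v ≡ label r w r≢w → v ≡ w) where

  private
    representative? : ∀ c → Dec (∃ λ r → f r ≡ c)
    representative? c = Fin.any? (λ r → f r Fin.≟ c)

    index : ∀ {c} → Dec (∃ λ r → f r ≡ c) → Fin n → Fin (suc k)
    -- Default value: at `c = f v` the point `v` is itself a preimage, so this case never arises
    -- there.
    index (no _)        v = Fin.zero
    index (yes (r , _)) v with r Fin.≟ v
    ... | yes _   = Fin.zero
    ... | no  r≢v = Fin.suc (label r v r≢v)

    -- Sharing `r?` compares both points with one and the same `r`; zero then marks `r` itself and
    -- the successors are labels seen from `r`.
    index-injective : ∀ {c} (r? : Dec (∃ λ r → f r ≡ c)) {v w} → f v ≡ c → f w ≡ c →
                      index r? v ≡ index r? w → v ≡ w
    index-injective (no ∄r)        {v}     fv _  _ = contradiction (v , fv) ∄r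
    index-injective (yes (r , fr)) {v} {w} fv fw eq with r Fin.≟ v | r Fin.≟ w
    ... | yes r≡v | yes r≡w = trans (sym r≡v) r≡w
    ... | no r≢v  | no r≢w  =
      label-injective r≢v r≢w (trans fr (sym fv)) (trans fr (sym fw)) (Fin.suc-injective eq)

    code : Fin n → Fin (m ℕ.* suc k)
    code v = combine (f v) (index (representative? (f v)) v)

    code-injective : ∀ {v w} → code v ≡ code w → v ≡ w
    code-injective {v} {w} eq
      with fv≡fw , index≡ ← Fin.combine-injective (f v) _ (f w) _ eq =
      index-injective (representative? (f v)) refl (sym fv≡fw)
        -- The indices belong to `f v` and `f w`; transport along `fv≡fw` makes them refer to the
        -- same representative.
        (trans index≡ (cong (λ c → index (representative? c) w) (sym fv≡fw)))

  -- A point is coded by its class and its position there: it is the representative or carries one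
  -- of `k` labels.
  fibres-≤⇒size-≤ : n ℕ.≤ m ℕ.* suc k
  fibres-≤⇒size-≤ = Fin.injective⇒≤ code-injective

n<2^n : ∀ n → n ℕ.< 2 ℕ.^ n
n<2^n zero    = ℕ.z<s
n<2^n (suc n) = begin-strict
  suc n                  <⟨ ℕ.s<s (n<2^n n) ⟩
  1 ℕ.+ 2 ℕ.^ n          ≤⟨ ℕ.+-monoˡ-≤ (2 ℕ.^ n) (ℕ.m^n>0 2 n) ⟩
  2 ℕ.^ n ℕ.+ 2 ℕ.^ n    ≡⟨ cong (2 ℕ.^ n ℕ.+_) (ℕ.+-identityʳ _) ⟨
  2 ℕ.^ suc n            ∎
  where open ℕ.≤-Reasoning

-- Conflict-free edge colourings

module _ {H : Graph} where
  open Graph H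
  open Edge

  -- An edge stores its ends in increasing order; this view forgets the order, so that arguments may
  -- exchange the ends.
  data Joins (e : Edge H) : Vertex → Vertex → Set where
    forward  : Joins e (end₁ e) (end₂ e)
    backward : Joins e (end₂ e) (end₁ e)

  Joins-sym : ∀ {e x y} → Joins e x y → Joins e y x
  Joins-sym forward  = backward
  Joins-sym backward = forward

  Joins⇒end : ∀ {e x y} → Joins e x y → x isEndOf e
  Joins⇒end forward  = inj₁ refl
  Joins⇒end backward = inj₂ refl

  ends-of-Joins : ∀ {e x y w} → Joins e x y → w isEndOf e → w ≡ x ⊎ w ≡ y
  ends-of-Joins forward  w∈e      = w∈e
  ends-of-Joins backward (inj₁ p) = inj₂ p
  ends-of-Joins backward (inj₂ p) = inj₁ p

  -- The field `ordered` is irrelevant; deciding the inequality again yields a relevant proof.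
  number-ordered : (e : Edge H) → number (end₁ e) ℕ.< number (end₂ e)
  number-ordered (edge u v u<v _) = recompute (number u ℕ.<? number v) u<v

  end₁≢end₂ : (e : Edge H) → end₁ e ≢ end₂ e
  end₁≢end₂ e eq = ℕ.<⇒≢ (number-ordered e) (cong number eq)

  -- A crossed match would reverse the numbering, and a doubled one would identify the two ends of
  -- `e`.
  ends-determine : (e f : Edge H) → end₁ e isEndOf f → end₂ e isEndOf f → e ≡ f
  ends-determine e f (inj₁ p) (inj₁ q) = contradiction (trans p (sym q)) (end₁≢end₂ e)
  ends-determine (edge _ _ _ _) (edge _ _ _ _) (inj₁ refl) (inj₂ refl) = refl
  ends-determine e f (inj₂ p) (inj₁ q) =
    contradiction (number-ordered e)
      (ℕ.<⇒≯ (subst₂ (λ u v → number u ℕ.< number v) (sym q) (sym p) (number-ordered f)))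
  ends-determine e f (inj₂ p) (inj₂ q) = contradiction (trans p (sym q)) (end₁≢end₂ e)

  Joins-determine : ∀ {e x y} (f : Edge H) → Joins e x y → x isEndOf f → y isEndOf f → e ≡ f
  Joins-determine {e} f forward  x∈f y∈f = ends-determine e f x∈f y∈f
  Joins-determine {e} f backward x∈f y∈f = ends-determine e f y∈f x∈f

  Joins⇒∈N : ∀ {e x y} → Joins e x y → (g : Edge H) → x isEndOf g → _∈N[_] (lineGraph H) g e
  Joins⇒∈N {e} {x} e-xy g x∈g with edge-≟ e g
  ... | yes e≡g = inj₁ (sym e≡g)
  ... | no  e≢g = inj₂ (e≢g , x , Joins⇒end e-xy , x∈g)

  module _ {k : ℕ} (φ : Edge H → Fin k) where

    OccursOnceAt : Fin k → Vertex → Set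
    OccursOnceAt a v = ∃! _≡_ λ e → v isEndOf e × φ e ≡ a

    occursOnceAt? : ∀ a v → Dec (OccursOnceAt a v)
    occursOnceAt? a v = finite-any? edge-finite λ e →
      (v isEndOf? e ×-dec φ e Fin.≟ a) ×-dec
      map′ (λ h {g} → h g) (λ h g → h {g})
        (finite-all? edge-finite λ g → (v isEndOf? g ×-dec φ g Fin.≟ a) →-dec edge-≟ e g)

    abstract
      -- The set S(v), as its characteristic function encoded in a number below `2 ^ k`.
      signature : Vertex → Fin (2 ℕ.^ k)
      signature v = funToFin (λ a → indicator (occursOnceAt? a v))

      signature-≡⇒ : ∀ {v w} → signature v ≡ signature w → ∀ a → OccursOnceAt a v → OccursOnceAt a w
      signature-≡⇒ {v} {w} eq a =
        indicator-≡⇒ (occursOnceAt? a v) (occursOnceAt? a w) (funToFin-injective _ _ eq a)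

    module _ (cf : ConflictFree (lineGraph H) φ) where

      -- The colour unique around `e` turns out to sit on `e` itself, and every edge at `x` lies in
      -- the closed neighborhood of `e`.
      same-signature⇒sole-colour : ∀ {e x y} → Joins e x y → signature x ≡ signature y →
        ∀ g → x isEndOf g → φ g ≡ φ e → e ≡ g
      same-signature⇒sole-colour {e} {x} {y} e-xy Sx≡Sy g x∈g φg≡φe
        with cf e
      ... | a , f , (f∈N , φf≡a) , unique =
        trans (sym (f≡e f∈N)) (unique (Joins⇒∈N e-xy g x∈g ,
          trans φg≡φe (trans (sym (cong φ (f≡e f∈N))) φf≡a)))
        where
        spreads : ∀ {w z} → Joins e w z → signature w ≡ signature z → w isEndOf f → f ≡ e
        spreads e-wz Sw≡Sz w∈f
          -- `f` is the only edge of colour `a` at `w`, so equal signatures put `a` on some edge `h`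
          -- at `z`.
          with h , (z∈h , φh≡a) , _ ← signature-≡⇒ Sw≡Sz a
            (f , (w∈f , φf≡a) , λ {g} (w∈g , φg≡a) → unique (Joins⇒∈N e-wz g w∈g , φg≡a))
          -- `h` also lies in the closed neighborhood of `e`, so `h` is `f`, which thus contains
          -- both ends of `e`.
          with refl ← unique (Joins⇒∈N (Joins-sym e-wz) h z∈h , φh≡a)
          = sym (Joins-determine f e-wz w∈f z∈h)

        f≡e : _∈N[_] (lineGraph H) f e → f ≡ e
        f≡e (inj₁ f≡e) = f≡e
        f≡e (inj₂ (_ , w , w∈e , w∈f)) with ends-of-Joins e-xy w∈e
        ... | inj₁ refl = spreads e-xy Sx≡Sy w∈f
        ... | inj₂ refl = spreads (Joins-sym e-xy) (sym Sx≡Sy) w∈f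

-- Complete graphs

module _ {n : ℕ} where

  joining : ∀ (x y : Fin n) → x ≢ y → ∃ λ (e : Edge (completeGraph n)) → Joins e x y
  joining x y x≢y with ℕ.<-cmp (toℕ x) (toℕ y)
  ... | tri< x<y _ _ = edge x y x<y x≢y , forward
  ... | tri≈ _ x≡y _ = contradiction (Fin.toℕ-injective x≡y) x≢y
  ... | tri> _ _ y<x = edge y x y<x (x≢y ∘ sym) , backward

  -- The classes are the fibres of the signature, and the label of `v` seen from `r` is the colour
  -- of the edge joining them.
  cfColourable⇒n≤ : ∀ {k} → CFColourable (lineGraph (completeGraph n)) k → n ℕ.≤ 2 ℕ.^ k ℕ.* suc k
  cfColourable⇒n≤ (φ , cf) = fibres-≤⇒size-≤ (signature φ) (λ r v r≢v → φ (proj₁ (joining r v r≢v))) distinct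
    where
    distinct : ∀ {r v w} (r≢v : r ≢ v) (r≢w : r ≢ w) →
               signature φ r ≡ signature φ v → signature φ r ≡ signature φ w →
               φ (proj₁ (joining r v r≢v)) ≡ φ (proj₁ (joining r w r≢w)) → v ≡ w
    distinct {r} {v} {w} r≢v r≢w Sr≡Sv _ φ≡
      with joining r v r≢v | joining r w r≢w
    ... | e , e-rv | g , g-rw
      -- The two edges at `r` have one colour, so they coincide, and `v` is an end of the edge from
      -- `r` to `w`.
      with refl ← same-signature⇒sole-colour φ cf e-rv Sr≡Sv g (Joins⇒end g-rw) (sym φ≡)
      with ends-of-Joins g-rw (Joins⇒end (Joins-sym e-rv))
    ... | inj₁ v≡r = contradiction (sym v≡r) r≢v
    ... | inj₂ v≡w = v≡w

n≤2^2χCF : ∀ n → let χ = χCF (lineGraph (completeGraph n)) in n ℕ.≤ 2 ℕ.^ (χ ℕ.+ χ)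
n≤2^2χCF n = begin
  n                        ≤⟨ cfColourable⇒n≤ (proj₁ (proj₂ (cfChromaticNumber (lineGraph (completeGraph n))))) ⟩
  -- `χ < 2 ^ χ` is by definition `suc χ ≤ 2 ^ χ`.
  2 ℕ.^ χ ℕ.* suc χ        ≤⟨ ℕ.*-monoʳ-≤ (2 ℕ.^ χ) (n<2^n χ) ⟩
  2 ℕ.^ χ ℕ.* 2 ℕ.^ χ      ≡⟨ ℕ.^-distribˡ-+-* 2 χ χ ⟨
  2 ℕ.^ (χ ℕ.+ χ)          ∎
  where
  open ℕ.≤-Reasoning
  χ = χCF (lineGraph (completeGraph n))

-- Lower sums of the logarithm

-- `_/_` reduces fractions; on unnormalised rationals the order is cross multiplication by
-- definition.
/-mono-≤ : ∀ {m n} b d .{{_ : NonZero b}} .{{_ : NonZero d}} →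
           m ℕ.* d ℕ.≤ n ℕ.* b → (+ m) / b ≤ (+ n) / d
/-mono-≤ {m} {n} (suc b) (suc d) md≤nb = ℚ.toℚᵘ-cancel-≤ (begin
  _               ≃⟨ ℚ.toℚᵘ-fromℚᵘ (mkℚᵘ (+ m) b) ⟩
  mkℚᵘ (+ m) b    ≤⟨ *≤* (subst₂ ℤ._≤_ (ℤ.pos-* m (suc d)) (ℤ.pos-* n (suc b)) (ℤ.+≤+ md≤nb)) ⟩
  mkℚᵘ (+ n) d    ≃⟨ ℚ.toℚᵘ-fromℚᵘ (mkℚᵘ (+ n) d) ⟨
  _               ∎)
  where open ℚᵘ.≤-Reasoning

/-homo-+ : ∀ m n d .{{_ : NonZero d}} → (+ m) / d + (+ n) / d ≡ (+ (m ℕ.+ n)) / d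
/-homo-+ m n (suc d) = ℚ.toℚᵘ-injective (begin-equality
  _                                ≃⟨ ℚ.toℚᵘ-homo-+ ((+ m) / suc d) ((+ n) / suc d) ⟩
  _                                ≃⟨ ℚᵘ.+-cong (ℚ.toℚᵘ-fromℚᵘ (mkℚᵘ (+ m) d)) (ℚ.toℚᵘ-fromℚᵘ (mkℚᵘ (+ n) d)) ⟩
  mkℚᵘ (+ m) d ℚᵘ.+ mkℚᵘ (+ n) d   ≃⟨ *≡* same-denominator ⟩
  mkℚᵘ (+ (m ℕ.+ n)) d             ≃⟨ ℚ.toℚᵘ-fromℚᵘ (mkℚᵘ (+ (m ℕ.+ n)) d) ⟨
  _                                ∎)
  where
  open ℚᵘ.≤-Reasoning
  D = + suc d
  same-denominator : ((+ m) ℤ.* D ℤ.+ (+ n) ℤ.* D) ℤ.* D ≡ (+ (m ℕ.+ n)) ℤ.* (D ℤ.* D)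
  same-denominator = trans (cong (ℤ._* D) (sym (ℤ.*-distribʳ-+ D (+ m) (+ n)))) (ℤ.*-assoc (+ (m ℕ.+ n)) D D)

reciprocalSum-+ : ∀ k m p → reciprocalSum k (m ℕ.+ p) ≡ reciprocalSum k m + reciprocalSum (k ℕ.+ m) p
reciprocalSum-+ k m zero rewrite ℕ.+-identityʳ m = sym (ℚ.+-identityʳ _)
reciprocalSum-+ k m (suc p) rewrite ℕ.+-suc m p | reciprocalSum-+ k m p | ℕ.+-assoc k m p =
  ℚ.+-assoc (reciprocalSum k m) _ _

reciprocalSum-nonNeg : ∀ k m → 0ℚ ≤ reciprocalSum k m
reciprocalSum-nonNeg k zero    = ℚ.≤-refl
reciprocalSum-nonNeg k (suc m) =
  ℚ.+-mono-≤ (reciprocalSum-nonNeg k m) (/-mono-≤ {0} {1} 1 (suc (k ℕ.+ m)) ℕ.z≤n)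

reciprocalSum-monoʳ-≤ : ∀ k {m p} → m ℕ.≤ p → reciprocalSum k m ≤ reciprocalSum k p
reciprocalSum-monoʳ-≤ k {m} {p} m≤p = begin
  reciprocalSum k m                                        ≡⟨ ℚ.+-identityʳ _ ⟨
  reciprocalSum k m + 0ℚ                                   ≤⟨ ℚ.+-monoʳ-≤ (reciprocalSum k m) (reciprocalSum-nonNeg (k ℕ.+ m) (p ℕ.∸ m)) ⟩
  reciprocalSum k m + reciprocalSum (k ℕ.+ m) (p ℕ.∸ m)    ≡⟨ reciprocalSum-+ k m (p ℕ.∸ m) ⟨
  reciprocalSum k (m ℕ.+ (p ℕ.∸ m))                        ≡⟨ cong (reciprocalSum k) (ℕ.m+[n∸m]≡n m≤p) ⟩
  reciprocalSum k p                                        ∎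
  where open ℚ.≤-Reasoning

-- Each of the `m` denominators exceeds `k`.
reciprocalSum-≤ : ∀ k m .{{_ : NonZero k}} → reciprocalSum k m ≤ (+ m) / k
reciprocalSum-≤ k zero    = /-mono-≤ {0} {0} 1 k ℕ.z≤n
reciprocalSum-≤ k (suc m) = begin
  reciprocalSum k m + (+ 1) / suc (k ℕ.+ m)   ≤⟨ ℚ.+-mono-≤ (reciprocalSum-≤ k m) (/-mono-≤ {1} {1} (suc (k ℕ.+ m)) k (ℕ.*-monoʳ-≤ 1 (ℕ.m≤n⇒m≤1+n (ℕ.m≤m+n k m)))) ⟩
  (+ m) / k + (+ 1) / k                       ≡⟨ /-homo-+ m 1 k ⟩
  (+ (m ℕ.+ 1)) / k                           ≡⟨ cong (λ i → (+ i) / k) (ℕ.+-comm m 1) ⟩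
  (+ suc m) / k                               ∎
  where open ℚ.≤-Reasoning

reciprocalSum-doubling : ∀ k .{{_ : NonZero k}} → reciprocalSum k k ≤ (+ 1) / 1
reciprocalSum-doubling k =
  ℚ.≤-trans (reciprocalSum-≤ k k) (/-mono-≤ {k} {1} k 1 (ℕ.≤-reflexive (ℕ.*-comm k 1)))

-- The number m of terms with k + m = 2ʲ k.
doublings : ℕ → ℕ → ℕ
doublings k zero    = 0
doublings k (suc j) = doublings k j ℕ.+ (k ℕ.+ doublings k j)

k+doublings : ∀ k j → k ℕ.+ doublings k j ≡ 2 ℕ.^ j ℕ.* k
k+doublings k zero    = refl
k+doublings k (suc j) = begin
  k ℕ.+ (d ℕ.+ (k ℕ.+ d))              ≡⟨ ℕ.+-assoc k d (k ℕ.+ d) ⟨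
  (k ℕ.+ d) ℕ.+ (k ℕ.+ d)              ≡⟨ cong₂ ℕ._+_ (k+doublings k j) (k+doublings k j) ⟩
  2 ℕ.^ j ℕ.* k ℕ.+ 2 ℕ.^ j ℕ.* k      ≡⟨ ℕ.*-distribʳ-+ k (2 ℕ.^ j) (2 ℕ.^ j) ⟨
  (2 ℕ.^ j ℕ.+ 2 ℕ.^ j) ℕ.* k          ≡⟨ cong (λ i → (2 ℕ.^ j ℕ.+ i) ℕ.* k) (ℕ.+-identityʳ (2 ℕ.^ j)) ⟨
  2 ℕ.^ suc j ℕ.* k                    ∎
  where
  open ≡-Reasoning
  d = doublings k j

-- Oresme's block argument: each doubling of the last denominator adds a block of sum at most 1, a
-- crude form of ln 2 ≤ 1.
reciprocalSum-doublings : ∀ k j .{{_ : NonZero k}} → reciprocalSum k (doublings k j) ≤ (+ j) / 1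
reciprocalSum-doublings k zero    = ℚ.≤-refl
-- With `k` a successor, `k ℕ.+ d` reduces to one, which supplies its `NonZero` instance.
reciprocalSum-doublings k@(suc _) (suc j) = begin
  reciprocalSum k (d ℕ.+ (k ℕ.+ d))                        ≡⟨ reciprocalSum-+ k d (k ℕ.+ d) ⟩
  reciprocalSum k d + reciprocalSum (k ℕ.+ d) (k ℕ.+ d)    ≤⟨ ℚ.+-mono-≤ (reciprocalSum-doublings k j) (reciprocalSum-doubling (k ℕ.+ d)) ⟩
  (+ j) / 1 + (+ 1) / 1                                    ≡⟨ /-homo-+ j 1 1 ⟩
  (+ (j ℕ.+ 1)) / 1                                        ≡⟨ cong (λ i → (+ i) / 1) (ℕ.+-comm j 1) ⟩
  (+ suc j) / 1                                            ∎
  where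
  open ℚ.≤-Reasoning
  d = doublings k j

-- The denominators of the lower sum do not exceed `n * k`, hence not `2 ^ j * k`, where the first
-- `doublings k j` terms end.
lnLowerSum-≤ : ∀ n k j .{{_ : NonZero k}} → n ℕ.≤ 2 ℕ.^ j → lnLowerSum n k ≤ (+ j) / 1
lnLowerSum-≤ n k j n≤2^j =
  ℚ.≤-trans (reciprocalSum-monoʳ-≤ k enough) (reciprocalSum-doublings k j)
  where
  open ℕ.≤-Reasoning
  enough : (n ℕ.∸ 1) ℕ.* k ℕ.≤ doublings k j
  enough = begin
    (n ℕ.∸ 1) ℕ.* k                  ≡⟨ ℕ.*-distribʳ-∸ k n 1 ⟩
    n ℕ.* k ℕ.∸ 1 ℕ.* k              ≤⟨ ℕ.∸-monoˡ-≤ (1 ℕ.* k) (ℕ.*-monoˡ-≤ k n≤2^j) ⟩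
    2 ℕ.^ j ℕ.* k ℕ.∸ 1 ℕ.* k        ≡⟨ cong₂ ℕ._∸_ (sym (k+doublings k j)) (ℕ.*-identityˡ k) ⟩
    (k ℕ.+ doublings k j) ℕ.∸ k      ≡⟨ ℕ.m+n∸m≡n k (doublings k j) ⟩
    doublings k j                    ∎

½*-double : ∀ m → ½ * ((+ (m ℕ.+ m)) / 1) ≡ (+ m) / 1
½*-double m = begin
  ½ * ((+ (m ℕ.+ m)) / 1)    ≡⟨ cong (½ *_) (/-homo-+ m m 1) ⟨
  ½ * (q + q)                ≡⟨ ℚ.*-distribˡ-+ ½ q q ⟩
  ½ * q + ½ * q              ≡⟨ ℚ.*-distribʳ-+ q ½ ½ ⟨
  1ℚ * q                     ≡⟨ ℚ.*-identityˡ q ⟩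
  q                          ∎
  where
  open ≡-Reasoning
  q = (+ m) / 1

theorem3 : ∃ λ (c : ℚ) → 0ℚ < c × (∀ (n : ℕ) → n ℕ.> 1 → c ·ln n ≤ (+ χCF (lineGraph (completeGraph n)) / 1))
-- The constant `½` cancels the doubling in the exponent `χ ℕ.+ χ` of the bound on `n`.
theorem3 = ½ , ℚ.positive⁻¹ ½ , λ n _ k →
  let χ = χCF (lineGraph (completeGraph n)) in
  subst (½ * lnLowerSum n k ≤_) (½*-double χ)
    (ℚ.*-monoˡ-≤-nonNeg ½ (lnLowerSum-≤ n k (χ ℕ.+ χ) (n≤2^2χCF n)))
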